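{- Let $C$ be a constant and let $\mathbf{a}=(a_1\ge\cdots\ge a_C)$ be a sequence of non-negative integers encoded in unary. Let $b_n(\mathbf{a})$ be the number of $\mathbf{a}$-shifted ballot sequences $w_1,\ldots,w_n$ with $w_i\in\{1,\ldots,C\}$, that is, sequences such that for every $1\le i<C$ and every $j\le n$ we have $$\#\{k\mid w_k=i,\ k\le j\}+a_i\ \ge\ \#\{k\mid w_k=i+1,\ k\le j\}+a_{i+1}.$$ Then the function $(\mathbf{a},1^n)\mapsto b_n(\mathbf{a})$ is in $\#\mathsf{L}$.
   Context: The alphabet is $\Sigma=\{0,1\}$; $1^a$ is the string of $a$ ones; unary encoding of a tuple means $1^{a_1}\,0\,1^{a_2}\,0\cdots$ with $0$ as a delimiter. A function given only on strings of a specified form is extended by $0$ to all other strings. $\#\mathsf{L}$ is the class of functions $f:\Sigma^*\to\mathbb{N}_0$ such that $f(x)$ is the number of accepting computation paths on input $x$ of a fixed nondeterministic Turing machine with read-only input tape that uses $O(\log|x|)$ work space and halts on every computation path. Equivalently: there are a polynomial $q$ and a deterministic $O(\log|x|)$-space Turing machine $M$ with an additional read-once, left-to-right witness tape such that $f(x)=\#\{w\in\Sigma^{q(|x|)}\mid M(x,w)=\mathsf{yes}\}$. -}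

module Defs where

open import Data.Bool.Base using (Bool; true; false; T)
open import Data.Fin.Base using (Fin; toℕ)
open import Data.Fin.Properties using (all?) renaming (_≟_ to _≟ᶠ_)
open import Data.List.Base as List
  using (List; []; _∷_; [_]; _++_; length; filter; take; replicate; allFin; cartesianProductWith)
open import Data.List.Relation.Unary.Unique.Propositional using (Unique)
open import Data.Nat.Base using (ℕ; zero; suc; pred; _+_; _*_; _≤_; _≥_; _⊓_)
open import Data.Nat.Logarithm using (⌊log₂_⌋)
open import Data.Nat.Properties using (_≥?_) renaming (_≟_ to _≟ⁿ_)
open import Data.Product.Base using (∃; ∃₂; _×_; _,_)
open import Data.Vec.Base as Vec using (Vec; []; _∷_; lookup; toList)
open import Data.Vec.Relation.Unary.Linked using (Linked; linked?)
open import Function.Bundles using (_↔_)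
open import Induction.WellFounded using (Acc)
open import Relation.Binary.Construct.Closure.ReflexiveTransitive using (Star)
open import Relation.Binary.PropositionalEquality using (_≡_; refl)
open import Relation.Nullary using (Dec; yes; no)
open import Relation.Nullary.Decidable using (_→-dec_; map′)
open import Relation.Unary using (Pred; Decidable)

-- Strings over Σ = {0,1}; false is 0 and true is 1.
Word : Set
Word = List Bool

------------------------------------------------------------------------
-- Nondeterministic Turing machines with a read-only input tape

data Move : Set where
  left stay right : Move

-- The input is delimited by end markers: ⊢ x₁ … xₙ ⊣.
data InputSymbol : Set where
  ⊢ ⊣ : InputSymbol
  bit : Bool → InputSymbol

-- Position 0 holds ⊢, positions 1 … |x| hold x, position |x|+1 holds ⊣.
inputAt : Word → ℕ → InputSymbol
inputAt x       zero          = ⊢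
inputAt []      (suc _)       = ⊣
inputAt (b ∷ _) (suc zero)    = bit b
inputAt (_ ∷ x) (suc (suc i)) = inputAt x (suc i)

-- The head cannot leave ⊢ x ⊣; otherwise its position would be an
-- unbounded counter not charged as work space.
moveInput : Word → Move → ℕ → ℕ
moveInput x left  p = pred p
moveInput x stay  p = p
moveInput x right p = suc p ⊓ suc (length x)

-- A two-way infinite work tape, blank outside the finitely many cells
-- visited so far.  Both lists start with the cell next to the head.
record Tape (Γ : Set) : Set where
  constructor tape
  field
    before : List Γ
    head   : Γ
    after  : List Γ

module _ {Γ : Set} (blank : Γ) where

  blankTape : Tape Γ
  blankTape = tape [] blank []

  moveHead : Move → Tape Γ → Tape Γ
  moveHead left  (tape []       h rs)       = tape [] blank (h ∷ rs)
  moveHead left  (tape (l ∷ ls) h rs)       = tape ls l (h ∷ rs)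
  moveHead stay  t                          = t
  moveHead right (tape ls       h [])       = tape (h ∷ ls) blank []
  moveHead right (tape ls       h (r ∷ rs)) = tape (h ∷ ls) r rs

  writeAndMove : Γ × Move → Tape Γ → Tape Γ
  writeAndMove (g , m) t = moveHead m (record t { head = g })

visitedCells : {Γ : Set} → Tape Γ → ℕ
visitedCells (tape ls _ rs) = length ls + 1 + length rs

record Action (Q Γ : Set) (k : ℕ) : Set where
  constructor action
  field
    next      : Q
    inputMove : Move
    workMoves : Vec (Γ × Move) k

record NTM : Set₁ where
  field
    State       : Set
    stateCount  : ℕ
    finState    : State ↔ Fin stateCount
    Symbol      : Set
    symbolCount : ℕ
    finSymbol   : Symbol ↔ Fin symbolCount
    blank       : Symbol
    workTapes   : ℕ
    start       : State
    accepting   : State → Bool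
    -- The transition relation, given by the duplicate-free list of actions
    -- available; the machine halts exactly when there are none.
    δ           : State → InputSymbol → Vec Symbol workTapes →
                  List (Action State Symbol workTapes)
    δ-unique    : ∀ q s gs → Unique (δ q s gs)

module Computation (M : NTM) (x : Word) where
  open NTM M

  record Config : Set where
    constructor config
    field
      state    : State
      inputPos : ℕ
      tapes    : Vec (Tape Symbol) workTapes

  open Config

  initial : Config
  initial = config start 0 (Vec.replicate workTapes (blankTape blank))

  choices : Config → List (Action State Symbol workTapes)
  choices c = δ (state c) (inputAt x (inputPos c)) (Vec.map Tape.head (tapes c))

  apply : Action State Symbol workTapes → Config → Config
  apply (action q m ws) c =
    config q (moveInput x m (inputPos c)) (Vec.zipWith (writeAndMove blank) ws (tapes c))

  choose : (c : Config) → Fin (length (choices c)) → Config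
  choose c i = apply (List.lookup (choices c) i) c

  _⟶_ : Config → Config → Set
  c ⟶ c′ = ∃ λ i → c′ ≡ choose c i

  Reachable : Config → Set
  Reachable = Star _⟶_ initial

  -- Accessibility: every computation path from the initial configuration
  -- is finite.
  Halts : Set
  Halts = Acc (λ c′ c → c ⟶ c′) initial

  workSpace : Config → ℕ
  workSpace c = Vec.sum (Vec.map visitedCells (tapes c))

  data AcceptingPath (c : Config) : Set where
    accept : choices c ≡ [] → T (accepting (state c)) → AcceptingPath c
    step   : (i : Fin (length (choices c))) → AcceptingPath (choose c i) → AcceptingPath c

open Computation using (initial; Config; Reachable; Halts; workSpace; AcceptingPath)

-- O(log |x|) is read as c · (1 + ⌊log₂ |x|⌋), since the logarithm itself
-- vanishes at |x| = 1 and, by the library's convention, at |x| = 0.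
LogSpace : NTM → Set
LogSpace M = ∃ λ c → ∀ x (γ : Config M x) → Reachable M x γ →
  workSpace M x γ ≤ c * (1 + ⌊log₂ length x ⌋)

record #L (f : Word → ℕ) : Set₁ where
  field
    machine  : NTM
    halts    : ∀ x → Halts machine x
    logSpace : LogSpace machine
    counts   : ∀ x → AcceptingPath machine x (initial machine x) ↔ Fin (f x)

------------------------------------------------------------------------
-- Shifted ballot sequences

module _ {C : ℕ} where

  -- #{ k ∣ w_k = i , k ≤ j }
  occurrences : ∀ {n} → Vec (Fin C) n → Fin C → ℕ → ℕ
  occurrences w i j = length (filter (_≟ᶠ i) (take j (toList w)))

  -- Letters and entries of a are indexed from 0; (i , i′) ranges over the
  -- consecutive pairs.
  IsBallot : Vec ℕ C → ∀ {n} → Vec (Fin C) n → Set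
  IsBallot a {n} w = ∀ (i i′ : Fin C) → toℕ i′ ≡ suc (toℕ i) → (j : Fin (suc n)) →
    occurrences w i (toℕ j) + lookup a i ≥ occurrences w i′ (toℕ j) + lookup a i′

  isBallot? : (a : Vec ℕ C) → ∀ {n} → Decidable (IsBallot a {n})
  isBallot? a w = all? λ i → all? λ i′ → (toℕ i′ ≟ⁿ suc (toℕ i)) →-dec
    all? λ j → (occurrences w i (toℕ j) + lookup a i) ≥? (occurrences w i′ (toℕ j) + lookup a i′)

allSequences : ∀ C n → List (Vec (Fin C) n)
allSequences C zero    = [ [] ]
allSequences C (suc n) = cartesianProductWith _∷_ (allFin C) (allSequences C n)

ballotNumber : ∀ {C} → Vec ℕ C → ℕ → ℕ
ballotNumber {C} a n = length (filter (isBallot? a) (allSequences C n))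

------------------------------------------------------------------------
-- The function (a , 1ⁿ) ↦ bₙ(a) on strings

-- 1^a₁ 0 1^a₂ 0 … 1^a_C 0 1^n
encode : ∀ {C} → Vec ℕ C → ℕ → Word
encode []      n = replicate n true
encode (m ∷ a) n = replicate m true ++ false ∷ encode a n

Encodes : ∀ {C} → Pred (Vec ℕ C) _ → Word → Set
Encodes P x = ∃₂ λ a n → P a × encode a n ≡ x

encodes? : ∀ {C} {P : Pred (Vec ℕ C) _} → Decidable P → Decidable (Encodes P)
encodes? {zero} P? [] = map′ (λ p → [] , 0 , p , refl) (λ { ([] , zero , p , refl) → p }) (P? [])
encodes? {zero} P? (true ∷ x) =
  map′ (λ { ([] , n , p , refl) → [] , suc n , p , refl })
       (λ { ([] , suc n , p , refl) → [] , n , p , refl })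
       (encodes? P? x)
encodes? {zero} P? (false ∷ x) = no λ { ([] , zero , _ , ()) ; ([] , suc _ , _ , ()) }
encodes? {suc C} P? [] = no λ { (zero ∷ _ , _ , _ , ()) ; (suc _ ∷ _ , _ , _ , ()) }
encodes? {suc C} P? (false ∷ x) =
  map′ (λ { (a , n , p , refl) → zero ∷ a , n , p , refl })
       (λ { (zero ∷ a , n , p , refl) → a , n , p , refl })
       (encodes? (λ a → P? (zero ∷ a)) x)
encodes? {suc C} {P} P? (true ∷ x) =
  map′ (λ { (m ∷ a , n , p , refl) → suc m ∷ a , n , p , refl })
       (λ { (suc m ∷ a , n , p , refl) → m ∷ a , n , p , refl })
       (encodes? {P = λ { (m ∷ a) → P (suc m ∷ a) }} (λ { (m ∷ a) → P? (suc m ∷ a) }) x)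

-- The value is 0 on strings not encoding any (a , 1ⁿ) with a₁ ≥ ⋯ ≥ a_C.
ballotFunction : ℕ → Word → ℕ
ballotFunction C x with encodes? {C} (linked? _≥?_) x
... | yes (a , n , _) = ballotNumber a n
... | no _            = 0

module Submission where

-- The key observation is that a ballot sequence shifted by a is a tail of an
-- ordinary one.  Read 1^a₁ 0 1^a₂ 0 … 1^a_C 0 1^n from left to right, treat every
-- 1 of the i-th block (i ≤ C) as the letter i and every 1 of the last block as a
-- letter w_k of our choice, and let h_i be the number of letters i so far.  At the
-- end of block C the heights (h₁ , … , h_C) are equal to a, and they have been
-- decreasing all the time exactly when a₁ ≥ ⋯ ≥ a_C; from then on they stay
-- decreasing exactly when w is a-shifted ballot.  So a machine can do with one
-- left-to-right scan in which all letters, read or guessed, are treated alike,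
-- and its accepting paths correspond to the ballot sequences.  On all other
-- strings every path gets stuck: the heights fail to be decreasing, the input ends
-- before the last block, or a 0 occurs in the last block.
--
-- To check that the heights stay decreasing, tape i holds the gap h_i - h_(i+1)
-- as a binary counter (the content of the last tape is irrelevant).  The letter i
-- increments counter i and decrements counter i-1; the path dies when a counter
-- with value zero has to be decremented.  A counter never exceeds the number of
-- symbols read, so its length is logarithmic in the length of the input.
--
-- The proof has two halves, which meet in the function pathCount, defined by
-- recursion on the unread part of the input.  Combinatorially, pathCount started
-- with zero heights in the first block is the ballot function
-- (pathCount≡ballotFunction), because on the last block its recursion is that of
-- ballotNumber on the first letter of the sequence (ballotNumber-suc).
-- Operationally, the computation tree below a scanning configuration is finite,
-- stays within the space bound, and has exactly pathCount accepting paths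
-- (counted-scan).  The predicate Counted states these three properties of a
-- configuration at once.  It is proved backwards along the computation: a
-- deterministic step transfers it from the successor to the configuration itself.

open import Defs
open import Data.Bool.Base using (Bool; true; false; T; if_then_else_)
open import Data.Bool.Properties using (T-irrelevant)
open import Data.Empty using (⊥; ⊥-elim)
open import Data.Fin.Base using (Fin; zero; suc; toℕ; fromℕ; inject₁)
open import Data.Fin.Induction using (<-weakInduction)
open import Data.Fin.Patterns using (0F; 1F; 2F)
open import Data.Fin.Properties using (+↔⊎; *↔×; 1↔⊤; toℕ-inject₁) renaming (_≟_ to _≟ᶠ_)
open import Data.Fin.Relation.Unary.Top
  using (View; ‵fromℕ; ‵inj₁; ‵inject₁; view; view-fromℕ; view-inject₁)
open import Data.List.Base as List
  using (List; []; _∷_; [_]; _++_; _ʳ++_; length; map; filter; replicate; tabulate; allFin; cartesianProductWith)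
open import Data.List.Properties
  using (map-cong; map-∘; filter-++; filter-none; filter-all; length-++; length-map)
import Data.List.Relation.Unary.All as ListAll
import Data.List.Relation.Unary.AllPairs as AllPairs
open import Data.List.Relation.Unary.Unique.Propositional using (Unique)
import Data.List.Relation.Unary.Unique.Propositional.Properties as Unique
open import Data.Maybe.Base as Maybe using (Maybe; just; nothing)
open import Data.Nat.Base using (ℕ; zero; suc; _+_; _*_; _^_; _≤_; _≥_; _<_; z≤n; s≤s)
open import Data.Nat.ListAction using (sum)
open import Data.Nat.Logarithm using (⌊log₂_⌋; ⌊log₂⌋-mono-≤; ⌊log₂[2^n]⌋≡n)
open import Data.Nat.Properties hiding (≡-irrelevant)
open import Data.Product.Base using (∃; Σ; _×_; _,_)
import Data.Product.Function.Dependent.Propositional as Σ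
open import Data.Product.Function.NonDependent.Propositional using (_×-↔_)
open import Data.Sum.Base using (_⊎_; inj₁; inj₂)
open import Data.Sum.Function.Propositional using (_⊎-↔_)
open import Data.Unit.Base using (⊤; tt)
open import Data.Vec.Base as Vec using (Vec; []; _∷_; lookup; updateAt; zipWith; _[_]≔_)
open import Data.Vec.Properties
  using ( lookup-map; lookup-replicate; lookup∘updateAt; lookup∘updateAt′; lookup∘update; updateAt-updateAt
        ; []≔-lookup; map-[]≔; map-replicate; zipWith-identityˡ; zipWith-identityʳ)
open import Data.Vec.Relation.Unary.All as All using (All; []; _∷_)
import Data.Vec.Relation.Unary.All.Properties as All
open import Data.Vec.Relation.Unary.Linked using (Linked; linked?; []; [-]; _∷_)
open import Function.Base using (_∘_)
open import Function.Bundles using (_⇔_; mk⇔; Equivalence; _↔_; mk↔ₛ′)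
open import Function.Construct.Composition using (_↔-∘_)
open import Function.Construct.Identity using (↔-id)
open import Function.Construct.Symmetry using (↔-sym)
open import Induction.WellFounded using (Acc; acc)
open import Relation.Binary.Construct.Closure.ReflexiveTransitive using (Star; ε; _◅_)
open import Relation.Binary.PropositionalEquality hiding ([_])
open import Relation.Binary.PropositionalEquality.WithK using (≡-irrelevant)
open import Relation.Nullary using (yes; no; ¬_; does; contradiction)
open import Relation.Nullary.Decidable using (decidable-stable)
open import Relation.Unary using (Decidable)

private
  variable
    C n : ℕ

------------------------------------------------------------------------
-- Decreasing vectors

Decreasing : Vec ℕ C → Set
Decreasing = Linked _≥_

decreasing? : Decidable (Decreasing {C})
decreasing? = linked? _≥?_

-- The heights after one more letter i.
add : Fin C → Vec ℕ C → Vec ℕ C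
add i h = updateAt h i suc

decreasing⇒pairs : {h : Vec ℕ C} → Decreasing h →
                   ∀ i i′ → toℕ i′ ≡ suc (toℕ i) → lookup h i ≥ lookup h i′
decreasing⇒pairs [-] zero zero ()
decreasing⇒pairs {h = _ ∷ _ ∷ _} (p ∷ _) zero (suc zero) _ = p
decreasing⇒pairs (_ ∷ ps) (suc i) (suc i′) eq = decreasing⇒pairs ps i i′ (suc-injective eq)

pairs⇒decreasing : {h : Vec ℕ C} →
                   (∀ i i′ → toℕ i′ ≡ suc (toℕ i) → lookup h i ≥ lookup h i′) → Decreasing h
pairs⇒decreasing {h = []}        _  = []
pairs⇒decreasing {h = _ ∷ []}    _  = [-]
pairs⇒decreasing {h = _ ∷ _ ∷ _} ps =
  ps zero (suc zero) refl ∷ pairs⇒decreasing (λ i i′ eq → ps (suc i) (suc i′) (cong suc eq))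

------------------------------------------------------------------------
-- Ballot numbers by the first letter

-- The initial letter of a sequence can be counted as part of the shift instead.
occurrences-∷ : (a : Vec ℕ C) (i k : Fin C) (w : Vec (Fin C) n) (j : ℕ) →
                occurrences (i ∷ w) k (suc j) + lookup a k ≡ occurrences w k j + lookup (add i a) k
occurrences-∷ a i k w j with i ≟ᶠ k
... | yes refl = trans (sym (+-suc _ _)) (cong (occurrences w k j +_) (sym (lookup∘updateAt i a)))
... | no i≢k   = cong (occurrences w k j +_) (sym (lookup∘updateAt′ k i (i≢k ∘ sym) a))

-- The ballot condition on the empty prefix.
ballot⇒decreasing : {a : Vec ℕ C} {w : Vec (Fin C) n} → IsBallot a w → Decreasing a
ballot⇒decreasing ballot = pairs⇒decreasing (λ i i′ eq → ballot i i′ eq zero)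

ballot-∷ : {a : Vec ℕ C} → Decreasing a → (i : Fin C) (w : Vec (Fin C) n) →
           IsBallot a (i ∷ w) ⇔ IsBallot (add i a) w
ballot-∷ {a = a} dec i w = mk⇔
  (λ ballot k k′ eq j →
    subst₂ _≥_ (occurrences-∷ a i k w (toℕ j)) (occurrences-∷ a i k′ w (toℕ j)) (ballot k k′ eq (suc j)))
  (λ ballot k k′ eq → λ
    { zero    → decreasing⇒pairs dec k k′ eq
    ; (suc j) → subst₂ _≥_ (sym (occurrences-∷ a i k w (toℕ j))) (sym (occurrences-∷ a i k′ w (toℕ j)))
                  (ballot k k′ eq j) })

length-filter-map : {A B : Set} {P : B → Set} {Q : A → Set} (P? : Decidable P) (Q? : Decidable Q)
                    (f : A → B) → (∀ x → P (f x) ⇔ Q x) → ∀ xs →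
                    length (filter P? (map f xs)) ≡ length (filter Q? xs)
length-filter-map P? Q? f iff []       = refl
length-filter-map P? Q? f iff (x ∷ xs) with P? (f x) | Q? x
... | yes _ | yes _ = cong suc (length-filter-map P? Q? f iff xs)
... | no _  | no _  = length-filter-map P? Q? f iff xs
... | yes p | no ¬q = contradiction (Equivalence.to (iff x) p) ¬q
... | no ¬p | yes q = contradiction (Equivalence.from (iff x) q) ¬p

ballotNumber-suc : {a : Vec ℕ C} → Decreasing a → ∀ n →
                   ballotNumber a (suc n) ≡ sum (map (λ i → ballotNumber (add i a) n) (allFin C))
ballotNumber-suc {C} {a} dec n = go (allFin C)
  where
  ws = allSequences C n

  go : ∀ is → length (filter (isBallot? a) (cartesianProductWith _∷_ is ws))
            ≡ sum (map (λ i → ballotNumber (add i a) n) is)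
  go []       = refl
  go (i ∷ is) = begin
    length (filter (isBallot? a) (map (i ∷_) ws ++ cartesianProductWith _∷_ is ws))
      ≡⟨ cong length (filter-++ (isBallot? a) (map (i ∷_) ws) _) ⟩
    length (filter (isBallot? a) (map (i ∷_) ws) ++ filter (isBallot? a) (cartesianProductWith _∷_ is ws))
      ≡⟨ length-++ (filter (isBallot? a) (map (i ∷_) ws)) ⟩
    length (filter (isBallot? a) (map (i ∷_) ws)) + length (filter (isBallot? a) (cartesianProductWith _∷_ is ws))
      ≡⟨ cong₂ _+_ (length-filter-map (isBallot? a) (isBallot? (add i a)) (i ∷_) (ballot-∷ dec i) ws) (go is) ⟩
    ballotNumber (add i a) n + sum (map (λ i → ballotNumber (add i a) n) is) ∎
    where open ≡-Reasoning

ballotNumber-none : {a : Vec ℕ C} → ¬ Decreasing a → ∀ n → ballotNumber a n ≡ 0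
ballotNumber-none {C} {a} ¬dec n =
  cong length (filter-none (isBallot? a) {allSequences C n}
    (ListAll.universal (λ w → ¬dec ∘ ballot⇒decreasing {w = w}) _))

ballotNumber-zero : {a : Vec ℕ C} → Decreasing a → ballotNumber a 0 ≡ 1
ballotNumber-zero {a = a} dec =
  cong length (filter-all (isBallot? a) {[] ∷ []}
    ((λ { i i′ eq zero → decreasing⇒pairs dec i i′ eq }) ListAll.∷ ListAll.[]))

------------------------------------------------------------------------
-- Heights along a scan

-- m if h is decreasing, and 0 otherwise.
whenDecreasing : Vec ℕ C → ℕ → ℕ
whenDecreasing h m = if does (decreasing? h) then m else 0

whenDecreasing-yes : {h : Vec ℕ C} → Decreasing h → ∀ m → whenDecreasing h m ≡ m
whenDecreasing-yes {h = h} dec m with decreasing? h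
... | yes _   = refl
... | no ¬dec = contradiction dec ¬dec

whenDecreasing-no : {h : Vec ℕ C} → ¬ Decreasing h → ∀ m → whenDecreasing h m ≡ 0
whenDecreasing-no {h = h} ¬dec m with decreasing? h
... | yes dec = contradiction dec ¬dec
... | no _    = refl

-- Blocks are numbered from 0, and b : Fin (suc C) is the current one: inject₁ i is
-- the block of i-th letters, and fromℕ C the last one, whose ones stand for
-- arbitrary letters.  These are the letters that a 1 in block b may stand for.
letters : {b : Fin (suc C)} → View b → List (Fin C)
letters {C} ‵fromℕ    = allFin C
letters (‵inject₁ i) = [ i ]

-- The number of accepting paths when the input ends in block b.
endValue : {b : Fin (suc C)} → View b → ℕ
endValue ‵fromℕ    = 1
endValue (‵inj₁ _) = 0

-- What f gives for the block after b; 0 if b is the last block.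
nextBlock : {b : Fin (suc C)} → View b → (Fin (suc C) → ℕ) → ℕ
nextBlock ‵fromℕ       f = 0
nextBlock (‵inject₁ i) f = f (suc i)

-- The number of accepting ways to read x from block b on, with heights h, such that
-- the heights stay decreasing.
pathCount : Vec ℕ C → Fin (suc C) → Word → ℕ
pathCount h b []          = endValue (view b)
pathCount h b (true ∷ x)  =
  sum (map (λ i → whenDecreasing (add i h) (pathCount (add i h) b x)) (letters (view b)))
pathCount h b (false ∷ x) = nextBlock (view b) (λ b′ → pathCount h b′ x)

pathCount-last : (h : Vec ℕ C) → Decreasing h → ∀ n →
                 pathCount h (fromℕ C) (replicate n true) ≡ ballotNumber h n
pathCount-last {C} h dec zero    = trans (cong endValue (view-fromℕ C)) (sym (ballotNumber-zero dec))
pathCount-last {C} h dec (suc n) = begin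
  sum (map branch (letters (view (fromℕ C))))
    ≡⟨ cong (λ v → sum (map branch (letters v))) (view-fromℕ C) ⟩
  sum (map branch (allFin C))                                ≡⟨ cong sum (map-cong agree (allFin C)) ⟩
  sum (map (λ i → ballotNumber (add i h) n) (allFin C))      ≡⟨ ballotNumber-suc dec n ⟨
  ballotNumber h (suc n)                                     ∎
  where
  open ≡-Reasoning
  branch : Fin C → ℕ
  branch i = whenDecreasing (add i h) (pathCount (add i h) (fromℕ C) (replicate n true))
  agree : ∀ i → branch i ≡ ballotNumber (add i h) n
  agree i with decreasing? (add i h)
  ... | yes dec′ = pathCount-last (add i h) dec′ n
  ... | no ¬dec′ = sym (ballotNumber-none ¬dec′ n)

pathCount-true : (h : Vec ℕ C) (i : Fin C) (x : Word) →
                 pathCount h (inject₁ i) (true ∷ x) ≡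
                 whenDecreasing (add i h) (pathCount (add i h) (inject₁ i) x)
pathCount-true h i x rewrite view-inject₁ i = +-identityʳ _

pathCount-false : (h : Vec ℕ C) (i : Fin C) (x : Word) →
                  pathCount h (inject₁ i) (false ∷ x) ≡ pathCount h (suc i) x
pathCount-false h i x rewrite view-inject₁ i = refl

------------------------------------------------------------------------
-- The count on encodings

-- The encoding of (a , n) without its first b blocks.
encodeFrom : Fin (suc C) → Vec ℕ C → ℕ → Word
encodeFrom zero    a       n = encode a n
encodeFrom (suc b) (m ∷ a) n = encodeFrom b a n

encodeFrom-last : (a : Vec ℕ C) → ∀ n → encodeFrom (fromℕ C) a n ≡ replicate n true
encodeFrom-last []      n = refl
encodeFrom-last (m ∷ a) n = encodeFrom-last a n

encodeFrom-block : (i : Fin C) (a : Vec ℕ C) → ∀ n →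
  encodeFrom (inject₁ i) a n ≡ replicate (lookup a i) true ++ false ∷ encodeFrom (suc i) a n
encodeFrom-block zero    (m ∷ a) n = refl
encodeFrom-block (suc i) (m ∷ a) n = encodeFrom-block i a n

encodeFrom-add : (i : Fin C) (a : Vec ℕ C) → ∀ n →
  encodeFrom (inject₁ i) (add i a) n ≡ true ∷ encodeFrom (inject₁ i) a n
encodeFrom-add zero    (m ∷ a) n = refl
encodeFrom-add (suc i) (m ∷ a) n = encodeFrom-add i a n

-- The first b entries of a, followed by zeros: the heights on entering block b.
upTo : Fin (suc C) → Vec ℕ C → Vec ℕ C
upTo {C} zero a       = Vec.replicate C 0
upTo (suc b) (m ∷ a) = m ∷ upTo b a

upTo-last : (a : Vec ℕ C) → upTo (fromℕ C) a ≡ a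
upTo-last []      = refl
upTo-last (m ∷ a) = cong (m ∷_) (upTo-last a)

-- The heights inside block i, after k of its ones: the entries of a before i, then
-- k, then zeros.
partial : Fin C → ℕ → Vec ℕ C → Vec ℕ C
partial zero    k (m ∷ a) = k ∷ Vec.replicate _ 0
partial (suc i) k (m ∷ a) = m ∷ partial i k a

partial-zero : (i : Fin C) (a : Vec ℕ C) → partial i 0 a ≡ upTo (inject₁ i) a
partial-zero zero    (m ∷ a) = refl
partial-zero (suc i) (m ∷ a) = cong (m ∷_) (partial-zero i a)

partial-full : (i : Fin C) (a : Vec ℕ C) → partial i (lookup a i) a ≡ upTo (suc i) a
partial-full zero    (m ∷ a) = refl
partial-full (suc i) (m ∷ a) = cong (m ∷_) (partial-full i a)

add-partial : (i : Fin C) (k : ℕ) (a : Vec ℕ C) → add i (partial i k a) ≡ partial i (suc k) a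
add-partial zero    k (m ∷ a) = refl
add-partial (suc i) k (m ∷ a) = cong (m ∷_) (add-partial i k a)

zeros-decreasing : ∀ C → Decreasing (Vec.replicate C 0)
zeros-decreasing zero          = []
zeros-decreasing (suc zero)    = [-]
zeros-decreasing (suc (suc C)) = z≤n ∷ zeros-decreasing (suc C)

partial-decreasing : {a : Vec ℕ C} → Decreasing a → (i : Fin C) {k : ℕ} → k ≤ lookup a i →
                     Decreasing (partial i k a)
partial-decreasing {a = _ ∷ []}    _        zero          _   = [-]
partial-decreasing {a = _ ∷ _ ∷ _} _        zero          _   = z≤n ∷ zeros-decreasing _
partial-decreasing {a = _ ∷ _ ∷ _} (p ∷ ps) (suc zero)    k≤  = ≤-trans k≤ p ∷ partial-decreasing ps zero k≤
partial-decreasing {a = _ ∷ _ ∷ _} (p ∷ ps) (suc (suc i)) k≤  = p ∷ partial-decreasing ps (suc i) k≤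

-- Reading the remaining m ones of block i and the delimiter after them.
pathCount-block : {a : Vec ℕ C} → Decreasing a → (i : Fin C) → ∀ k m x → m + k ≡ lookup a i →
  pathCount (partial i k a) (inject₁ i) (replicate m true ++ false ∷ x) ≡ pathCount (upTo (suc i) a) (suc i) x
pathCount-block {a = a} dec i k zero    x refl =
  trans (pathCount-false _ i x) (cong (λ h → pathCount h (suc i) x) (partial-full i a))
pathCount-block {a = a} dec i k (suc m) x total = begin
  pathCount (partial i k a) (inject₁ i) (true ∷ y)
    ≡⟨ pathCount-true _ i y ⟩
  whenDecreasing (add i (partial i k a)) (pathCount (add i (partial i k a)) (inject₁ i) y)
    ≡⟨ cong (λ h → whenDecreasing h (pathCount h (inject₁ i) y)) (add-partial i k a) ⟩
  whenDecreasing (partial i (suc k) a) (pathCount (partial i (suc k) a) (inject₁ i) y)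
    ≡⟨ whenDecreasing-yes (partial-decreasing dec i (subst (suc k ≤_) total′ (m≤n+m (suc k) m))) _ ⟩
  pathCount (partial i (suc k) a) (inject₁ i) y
    ≡⟨ pathCount-block dec i (suc k) m x total′ ⟩
  pathCount (upTo (suc i) a) (suc i) x ∎
  where
  open ≡-Reasoning
  y = replicate m true ++ false ∷ x
  total′ : m + suc k ≡ lookup a i
  total′ = trans (+-suc m k) total

pathCount-encode : (a : Vec ℕ C) → Decreasing a → ∀ n →
                   pathCount (Vec.replicate C 0) zero (encode a n) ≡ ballotNumber a n
pathCount-encode {C} a dec n = begin
  pathCount (Vec.replicate C 0) zero (encode a n)
    ≡⟨ <-weakInduction Reaches refl advance (fromℕ C) ⟩
  pathCount (upTo (fromℕ C) a) (fromℕ C) (encodeFrom (fromℕ C) a n)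
    ≡⟨ cong₂ (λ h → pathCount h (fromℕ C)) (upTo-last a) (encodeFrom-last a n) ⟩
  pathCount a (fromℕ C) (replicate n true)
    ≡⟨ pathCount-last a dec n ⟩
  ballotNumber a n ∎
  where
  open ≡-Reasoning
  start : ℕ
  start = pathCount (Vec.replicate C 0) zero (encode a n)

  Reaches : Fin (suc C) → Set
  Reaches b = start ≡ pathCount (upTo b a) b (encodeFrom b a n)

  advance : ∀ i → Reaches (inject₁ i) → Reaches (suc i)
  advance i reached = trans reached (trans
    (cong₂ (λ h → pathCount h (inject₁ i)) (sym (partial-zero i a)) (encodeFrom-block i a n))
    (pathCount-block dec i 0 (lookup a i) _ (+-identityʳ _)))

------------------------------------------------------------------------
-- The count on other strings

_⊕_ : Vec ℕ C → Vec ℕ C → Vec ℕ C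
_⊕_ = zipWith _+_

add-⊕ : (i : Fin C) (h r : Vec ℕ C) → add i h ⊕ r ≡ h ⊕ add i r
add-⊕ zero    (_ ∷ h) (_ ∷ r) = cong (_∷ (h ⊕ r)) (sym (+-suc _ _))
add-⊕ (suc i) (_ ∷ h) (_ ∷ r) = cong (_ ∷_) (add-⊕ i h r)

-- The string x continues, from block b on, some encoding of a decreasing vector.
-- This vector is h ⊕ rest: h counts the ones read already, rest those still in x.
record Decodes (h : Vec ℕ C) (b : Fin (suc C)) (x : Word) : Set where
  constructor decodes
  field
    rest       : Vec ℕ C
    steps      : ℕ
    -- the blocks before b have been read completely
    unread     : ∀ j → toℕ j < toℕ b → lookup rest j ≡ 0
    encodes    : encodeFrom b rest steps ≡ x
    decreasing : Decreasing (h ⊕ rest)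

sum-zeros : {A : Set} (f : A → ℕ) → (∀ x → f x ≡ 0) → ∀ xs → sum (map f xs) ≡ 0
sum-zeros f zeros []       = refl
sum-zeros f zeros (x ∷ xs) = cong₂ _+_ (zeros x) (sum-zeros f zeros xs)

pathCount-last-ones : (x : Word) →
  (∃ λ n → x ≡ replicate n true) ⊎ ((h : Vec ℕ C) → pathCount h (fromℕ C) x ≡ 0)
pathCount-last-ones []              = inj₁ (0 , refl)
pathCount-last-ones {C} (false ∷ x) = inj₂ λ h → cong (λ v → nextBlock v (λ b → pathCount h b x)) (view-fromℕ C)
pathCount-last-ones {C} (true ∷ x)  with pathCount-last-ones {C} x
... | inj₁ (n , refl) = inj₁ (suc n , refl)
... | inj₂ none       = inj₂ λ h → sum-zeros _ (λ i → branch i h) (letters (view (fromℕ C)))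
  where
  branch : ∀ i h → whenDecreasing (add i h) (pathCount (add i h) (fromℕ C) x) ≡ 0
  branch i h with decreasing? (add i h)
  ... | yes _ = none (add i h)
  ... | no _  = refl

-- A nonzero number of accepting ways to read x means that x is well formed.
decode : (h : Vec ℕ C) (b : Fin (suc C)) (x : Word) → Decreasing h → pathCount h b x ≢ 0 → Decodes h b x
decode {C} h b x dec p with view b
decode {C} h _ x dec p | ‵fromℕ with pathCount-last-ones x
... | inj₂ none       = contradiction (none h) p
... | inj₁ (n , refl) =
  decodes (Vec.replicate C 0) n (λ j _ → lookup-replicate j 0) (encodeFrom-last (Vec.replicate C 0) n)
    (subst Decreasing (sym (zipWith-identityʳ +-identityʳ h)) dec)
decode {C} h _ [] dec p | ‵inject₁ i = contradiction (cong endValue (view-inject₁ i)) p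
decode {C} h _ (false ∷ x) dec p | ‵inject₁ i =
  let decodes r n unread enc dec′ = decode h (suc i) x dec (p ∘ trans (pathCount-false h i x))
      r-i = unread i ≤-refl
  in decodes r n (λ j j<i → unread j (<-trans (subst (toℕ j <_) (toℕ-inject₁ i) j<i) (n<1+n _)))
       (trans (encodeFrom-block i r n)
         (trans (cong (λ m → replicate m true ++ false ∷ encodeFrom (suc i) r n) r-i) (cong (false ∷_) enc)))
       dec′
decode {C} h _ (true ∷ x) dec p | ‵inject₁ i with decreasing? (add i h)
... | no ¬dec = contradiction (trans (pathCount-true h i x) (whenDecreasing-no ¬dec _)) p
... | yes dec₁ =
  let decodes r n unread enc dec′ = decode (add i h) (inject₁ i) x dec₁
                                         (p ∘ trans (trans (pathCount-true h i x) (whenDecreasing-yes dec₁ _)))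
  in decodes (add i r) n
       (λ j j<i → trans (lookup∘updateAt′ j i (λ { refl → <-irrefl (sym (toℕ-inject₁ i)) j<i }) r) (unread j j<i))
       (trans (encodeFrom-add i r n) (cong (true ∷_) enc))
       (subst Decreasing (add-⊕ i h r) dec′)

pathCount≡ballotFunction : ∀ C x → pathCount (Vec.replicate C 0) zero x ≡ ballotFunction C x
pathCount≡ballotFunction C x with encodes? {C} (linked? _≥?_) x
... | yes (a , n , dec , refl) = pathCount-encode a dec n
... | no not-encoding          = decidable-stable (_ ≟ _) λ nonzero →
  let decodes a n _ enc dec = decode (Vec.replicate C 0) zero x (zeros-decreasing C) nonzero
  in not-encoding (a , n , subst Decreasing (zipWith-identityˡ +-identityˡ a) dec , enc)

------------------------------------------------------------------------
-- Computation trees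

module Counting (M : NTM) (x : Word) (B : ℕ) where
  open NTM M
  open Computation M x

  -- The computation tree below c is finite, all its configurations use space at most
  -- B, and it has exactly the given number of accepting paths.  Requiring the state to
  -- be nonaccepting in branches makes the number right also for a configuration
  -- without successors.
  data Counted (c : Config) : ℕ → Set where
    accepts  : workSpace c ≤ B → choices c ≡ [] → T (accepting (Config.state c)) → Counted c 1
    branches : workSpace c ≤ B → ¬ T (accepting (Config.state c)) →
               (count : Fin (length (choices c)) → ℕ) →
               (∀ i → Counted (choose c i) (count i)) →
               Counted c (sum (tabulate count))

  private
    no-index : ∀ {A : Set} {as : List A} → as ≡ [] → ¬ Fin (length as)
    no-index refl ()

  counted⇒halts : ∀ {c m} → Counted c m → Acc (λ c′ c → c ⟶ c′) c
  counted⇒halts (accepts _ none _)    = acc λ { (i , refl) → ⊥-elim (no-index none i) }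
  counted⇒halts (branches _ _ _ subs) = acc λ { (i , refl) → counted⇒halts (subs i) }

  counted⇒space : ∀ {c m γ} → Counted c m → Star _⟶_ c γ → workSpace γ ≤ B
  counted⇒space (accepts s _ _)       ε                 = s
  counted⇒space (branches s _ _ _)    ε                 = s
  counted⇒space (branches _ _ _ subs) ((i , refl) ◅ γs) = counted⇒space (subs i) γs
  counted⇒space (accepts _ none _)    ((i , _) ◅ _)     = ⊥-elim (no-index none i)

  private
    ΣFin↔sum : ∀ {n} (count : Fin n → ℕ) → Σ (Fin n) (Fin ∘ count) ↔ Fin (sum (tabulate count))
    ΣFin↔sum {zero}  count = mk↔ₛ′ (λ { (() , _) }) (λ ()) (λ ()) (λ { (() , _) })
    ΣFin↔sum {suc n} count =
      ↔-sym +↔⊎ ↔-∘ ((↔-id _ ⊎-↔ ΣFin↔sum (count ∘ suc)) ↔-∘ split)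
      where
      split : Σ (Fin (suc n)) (Fin ∘ count) ↔ (Fin (count zero) ⊎ Σ (Fin n) (Fin ∘ count ∘ suc))
      split = mk↔ₛ′ (λ { (zero , k) → inj₁ k ; (suc i , k) → inj₂ (i , k) })
                    (λ { (inj₁ k) → zero , k ; (inj₂ (i , k)) → suc i , k })
                    (λ { (inj₁ _) → refl ; (inj₂ _) → refl })
                    (λ { (zero , _) → refl ; (suc _ , _) → refl })

  counted⇒paths : ∀ {c m} → Counted c m → AcceptingPath c ↔ Fin m
  counted⇒paths {c} (accepts _ none final) =
    mk↔ₛ′ (λ _ → zero) (λ _ → accept none final) (λ { zero → refl }) unique
    where
    unique : ∀ p → accept none final ≡ p
    unique (accept none′ final′) = cong₂ accept (≡-irrelevant none none′) (T-irrelevant final final′)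
    unique (step i _) = ⊥-elim (no-index none i)
  counted⇒paths {c} (branches _ nonfinal count subs) =
    ΣFin↔sum count ↔-∘ (Σ.congˡ (λ {i} → counted⇒paths (subs i)) ↔-∘ first-step)
    where
    first-step : AcceptingPath c ↔ ∃ λ i → AcceptingPath (choose c i)
    first-step = mk↔ₛ′ (λ { (accept _ final) → ⊥-elim (nonfinal final) ; (step i p) → i , p })
                       (λ { (i , p) → step i p })
                       (λ _ → refl)
                       (λ { (accept _ final) → ⊥-elim (nonfinal final) ; (step _ _) → refl })

  -- The way to use branches: the successors are given by a list of labels.
  counted-map : ∀ {A : Set} {c} (f : A → Action State Symbol workTapes) (as : List A) (count : A → ℕ) →
                workSpace c ≤ B → ¬ T (accepting (Config.state c)) →
                choices c ≡ map f as → (∀ a → Counted (apply (f a) c) (count a)) →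
                Counted c (sum (map count as))
  counted-map {c = c} f as count s nonfinal eq subs =
    let count′ , subs′ , total = branching as
    in subst (Counted c) total (transport (sym eq) count′ subs′)
    where
    Subtrees : (acts : List (Action State Symbol workTapes)) → (Fin (length acts) → ℕ) → Set
    Subtrees acts n = ∀ i → Counted (apply (List.lookup acts i) c) (n i)

    branching : ∀ as → ∃ λ n → Subtrees (map f as) n × sum (tabulate n) ≡ sum (map count as)
    branching []       = (λ ()) , (λ ()) , refl
    branching (a ∷ as) =
      let n , subs′ , total = branching as
      in (λ { zero → count a ; (suc i) → n i }) ,
         (λ { zero → subs a ; (suc i) → subs′ i }) ,
         cong (count a +_) total

    transport : ∀ {acts} → acts ≡ choices c → (n : Fin (length acts) → ℕ) → Subtrees acts n →
                Counted c (sum (tabulate n))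
    transport refl n subs′ = branches s nonfinal n subs′

  counted-one : ∀ {c a m} → workSpace c ≤ B → ¬ T (accepting (Config.state c)) →
                choices c ≡ a ∷ [] → Counted (apply a c) m → Counted c m
  counted-one {c} {a} {m} s nonfinal eq sub =
    subst (Counted c) (+-identityʳ m)
      (counted-map {A = ⊤} (λ _ → a) (tt ∷ []) (λ _ → m) s nonfinal eq (λ _ → sub))

  counted-none : ∀ {c} → workSpace c ≤ B → ¬ T (accepting (Config.state c)) →
                 choices c ≡ [] → Counted c 0
  counted-none s nonfinal eq = counted-map {A = ⊥} (λ ()) [] (λ ()) s nonfinal eq (λ ())

------------------------------------------------------------------------
-- Binary counters

-- Binary digits, least significant first.  Most significant zeros are allowed, so
-- that decrementing need not shorten the list.
Digits : Set
Digits = List Bool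

bit-value : Bool → ℕ
bit-value false = 0
bit-value true  = 1

value : Digits → ℕ
value []       = 0
value (d ∷ ds) = bit-value d + 2 * value ds

increment : Digits → Digits
increment []           = true ∷ []
increment (false ∷ ds) = true ∷ ds
increment (true ∷ ds)  = false ∷ increment ds

-- The value zero cannot be decremented.
decrement : Digits → Maybe Digits
decrement []           = nothing
decrement (true ∷ ds)  = just (false ∷ ds)
decrement (false ∷ ds) = Maybe.map (true ∷_) (decrement ds)

value-increment : ∀ ds → value (increment ds) ≡ suc (value ds)
value-increment []           = refl
value-increment (false ∷ ds) = refl
value-increment (true ∷ ds)  = trans (cong (2 *_) (value-increment ds)) (*-suc 2 (value ds))

-- What decrement has to satisfy.
DecrementOf : Digits → Maybe Digits → Set
DecrementOf ds nothing    = value ds ≡ 0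
DecrementOf ds (just ds′) = value ds ≡ suc (value ds′) × length ds′ ≡ length ds

decrement-correct : ∀ ds → DecrementOf ds (decrement ds)
decrement-correct []           = refl
decrement-correct (true ∷ ds)  = refl , refl
decrement-correct (false ∷ ds) with decrement ds | decrement-correct ds
... | nothing  | zero-value = cong (2 *_) zero-value
... | just ds′ | eq , len   = trans (cong (2 *_) eq) (*-suc 2 (value ds′)) , cong suc len

-- A counter only grows by overflow, and then its new value is a power of two.
increment-length : ∀ ds → length (increment ds) ≤ length ds ⊎
                   (length (increment ds) ≡ suc (length ds) × 2 ^ length ds ≤ value (increment ds))
increment-length []           = inj₂ (refl , ≤-refl)
increment-length (false ∷ ds) = inj₁ ≤-refl
increment-length (true ∷ ds)  with increment-length ds
... | inj₁ len≤          = inj₁ (s≤s len≤)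
... | inj₂ (len , power) = inj₂ (cong suc len , *-monoʳ-≤ 2 power)

increment-short : ∀ ds {N} → value (increment ds) ≤ N → length ds ≤ 1 + ⌊log₂ N ⌋ →
                  length (increment ds) ≤ 1 + ⌊log₂ N ⌋
increment-short ds {N} small short with increment-length ds
... | inj₁ len≤          = ≤-trans len≤ short
... | inj₂ (len , power) = subst (_≤ 1 + ⌊log₂ N ⌋) (sym len) (s≤s
  (subst (_≤ ⌊log₂ N ⌋) (⌊log₂[2^n]⌋≡n (length ds)) (⌊log₂⌋-mono-≤ (≤-trans power small))))

------------------------------------------------------------------------
-- Gaps between consecutive heights

-- The values of the counters are the differences of consecutive entries of h.  The
-- last counter is arbitrary.
data Gaps : Vec ℕ n → Vec Digits n → Set where
  []  : Gaps [] []
  [-] : ∀ {x ds} → Gaps (x ∷ []) (ds ∷ [])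
  _∷_ : ∀ {x ds} {h : Vec ℕ (suc n)} {dss} → x ≡ value ds + Vec.head h → Gaps h dss →
        Gaps (x ∷ h) (ds ∷ dss)

gaps⇒decreasing : {h : Vec ℕ n} {dss : Vec Digits n} → Gaps h dss → Decreasing h
gaps⇒decreasing []           = []
gaps⇒decreasing [-]          = [-]
gaps⇒decreasing (_∷_ {ds = ds} refl gaps) = m≤n+m _ (value ds) ∷ gaps⇒decreasing gaps

zeros-gaps : ∀ n → Gaps (Vec.replicate n 0) (Vec.replicate n [])
zeros-gaps zero          = []
zeros-gaps (suc zero)    = [-]
zeros-gaps (suc (suc n)) = refl ∷ zeros-gaps (suc n)

-- The effect of the first letter and of the other letters on heights and counters.
gaps-first : {h : Vec ℕ (suc n)} {dss : Vec Digits (suc n)} → Gaps h dss →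
             Gaps (add zero h) (dss [ zero ]≔ increment (lookup dss zero))
gaps-first [-] = [-]
gaps-first (_∷_ {ds = ds} refl gaps) = cong (_+ _) (sym (value-increment ds)) ∷ gaps

gaps-later : {h : Vec ℕ (suc n)} {dss : Vec Digits (suc n)} (j : Fin n) {ds : Digits} →
             value (lookup dss (inject₁ j)) ≡ suc (value ds) → Gaps h dss →
             Gaps (add (suc j) h) (dss [ suc j ]≔ increment (lookup dss (suc j)) [ inject₁ j ]≔ ds)
gaps-later {h = _ ∷ y ∷ _} {dss = _ ∷ _ ∷ _} zero {ds} eq (refl ∷ gaps) =
  trans (cong (_+ y) eq) (sym (+-suc (value ds) y)) ∷ gaps-first gaps
gaps-later {h = _ ∷ _ ∷ _} {dss = _ ∷ _ ∷ _} (suc j) eq (gap ∷ gaps) = gap ∷ gaps-later j eq gaps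

lookup-pred : {A : Set} (xs : Vec A (suc n)) (j : Fin n) {y : A} →
              lookup (xs [ suc j ]≔ y) (inject₁ j) ≡ lookup xs (inject₁ j)
lookup-pred (_ ∷ _ ∷ _) zero    = refl
lookup-pred (_ ∷ xs)    (suc j) = lookup-pred xs j

-- If the counter to be decremented is zero, the letter is not allowed.
gaps-blocked : {h : Vec ℕ (suc n)} {dss : Vec Digits (suc n)} (j : Fin n) →
               value (lookup dss (inject₁ j)) ≡ 0 → Gaps h dss → ¬ Decreasing (add (suc j) h)
gaps-blocked {h = _ ∷ y ∷ _} zero    eq (gap ∷ gaps) (x≥ ∷ _)
  rewrite eq | gap = <-irrefl refl x≥
gaps-blocked {h = _ ∷ _ ∷ _} (suc j) eq (_ ∷ gaps) (_ ∷ dec) = gaps-blocked j eq gaps dec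

------------------------------------------------------------------------
-- The machine

-- Tape symbols: blank, 0 and 1.
Symbol : Set
Symbol = Maybe Bool

-- The operations on counters.
data Op : Set where
  inc dec : Op

-- An operation on a counter leaves the blank cell to the left of the digits (start),
-- propagates the carry or borrow to the right (carry), and returns to the blank
-- cell (back).
data Stage : Set where
  start carry back : Stage

-- In scan b the machine is about to read an input symbol of block b; in work o g t b
-- it is in stage g of operation o on tape t, and will resume scanning in block b.
-- When work inc … i b is done with letter i, the decrement of tape i-1 is next.
data State (C : ℕ) : Set where
  accept : State C
  scan   : Fin (suc C) → State C
  work   : Op → Stage → Fin C → Fin (suc C) → State C

symbol↔ : Symbol ↔ Fin 3
symbol↔ = mk↔ₛ′ (λ { nothing → 0F ; (just false) → 1F ; (just true) → 2F })
                (λ { 0F → nothing ; 1F → just false ; 2F → just true })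
                (λ { 0F → refl ; 1F → refl ; 2F → refl })
                (λ { nothing → refl ; (just false) → refl ; (just true) → refl })

op↔ : Op ↔ Fin 2
op↔ = mk↔ₛ′ (λ { inc → 0F ; dec → 1F }) (λ { 0F → inc ; 1F → dec })
            (λ { 0F → refl ; 1F → refl }) (λ { inc → refl ; dec → refl })

stage↔ : Stage ↔ Fin 3
stage↔ = mk↔ₛ′ (λ { start → 0F ; carry → 1F ; back → 2F }) (λ { 0F → start ; 1F → carry ; 2F → back })
               (λ { 0F → refl ; 1F → refl ; 2F → refl })
               (λ { start → refl ; carry → refl ; back → refl })

state↔ : State C ↔ Fin (1 + (suc C + (2 * 3) * (C * suc C)))
state↔ {C} =
  ↔-sym +↔⊎ ↔-∘ ((↔-sym 1↔⊤ ⊎-↔ (↔-sym +↔⊎ ↔-∘ (↔-id _ ⊎-↔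
    (↔-sym *↔× ↔-∘ ((↔-sym *↔× ↔-∘ (op↔ ×-↔ stage↔)) ×-↔ ↔-sym *↔×))))) ↔-∘ summands)
  where
  summands : State C ↔ (⊤ ⊎ (Fin (suc C) ⊎ ((Op × Stage) × (Fin C × Fin (suc C)))))
  summands = mk↔ₛ′
    (λ { accept → inj₁ tt ; (scan b) → inj₂ (inj₁ b) ; (work o s t b) → inj₂ (inj₂ ((o , s) , (t , b))) })
    (λ { (inj₁ tt) → accept ; (inj₂ (inj₁ b)) → scan b ; (inj₂ (inj₂ ((o , s) , (t , b)))) → work o s t b })
    (λ { (inj₁ tt) → refl ; (inj₂ (inj₁ b)) → refl ; (inj₂ (inj₂ ((o , s) , (t , b)))) → refl })
    (λ { accept → refl ; (scan b) → refl ; (work o s t b) → refl })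

-- The state after an operation on tape t.
done : Op → Fin C → Fin (suc C) → State C
done inc (suc t) b = work dec start (inject₁ t) b
done inc zero    b = scan b
done dec _       b = scan b

-- A step on the current tape, given the symbol under its head; none if a counter with
-- value zero is to be decremented, that is, if a borrow passes beyond the last digit.
workStep : Stage → Op → Fin C → Fin (suc C) → Symbol → Maybe (State C × Symbol × Move)
workStep start o   t b s            = just (work o carry t b , s , right)
workStep carry inc t b (just true)  = just (work inc carry t b , just false , right)
workStep carry inc t b (just false) = just (work inc back t b , just true , left)
workStep carry inc t b nothing      = just (work inc back t b , just true , left)
workStep carry dec t b (just false) = just (work dec carry t b , just true , right)
workStep carry dec t b (just true)  = just (work dec back t b , just false , left)
workStep carry dec t b nothing      = nothing
workStep back  o   t b (just d)     = just (work o back t b , just d , left)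
workStep back  o   t b nothing      = just (done o t b , nothing , stay)

-- The possible steps on reading an input symbol in block b.  The work tapes are left
-- alone.
scanSteps : InputSymbol → {b : Fin (suc C)} → View b → List (State C × Move)
scanSteps ⊢           {b} _            = (scan b , right) ∷ []
scanSteps ⊣           ‵fromℕ           = (accept , stay) ∷ []
scanSteps ⊣           (‵inj₁ _)        = []
scanSteps (bit true)  {b} v            = map (λ i → work inc start i b , right) (letters v)
scanSteps (bit false) ‵fromℕ           = []
scanSteps (bit false) (‵inject₁ i)     = (scan (suc i) , right) ∷ []

unmoved : Vec Symbol C → Vec (Symbol × Move) C
unmoved = Vec.map (_, stay)

scanAction : Vec Symbol C → State C × Move → Action (State C) Symbol C
scanAction gs (q , m) = action q m (unmoved gs)

workAction : Fin C → Vec Symbol C → State C × Symbol × Move → Action (State C) Symbol C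
workAction t gs (q , wm) = action q stay (unmoved gs [ t ]≔ wm)

actions : State C → InputSymbol → Vec Symbol C → List (Action (State C) Symbol C)
actions accept         _ _  = []
actions (scan b)       s gs = map (scanAction gs) (scanSteps s (view b))
actions (work o g t b) _ gs = List.fromMaybe (Maybe.map (workAction t gs) (workStep g o t b (lookup gs t)))

private
  unique-[-] : {A : Set} {x : A} → Unique (x ∷ [])
  unique-[-] = ListAll.[] AllPairs.∷ AllPairs.[]

letters-unique : {b : Fin (suc C)} (v : View b) → Unique (letters v)
letters-unique {C} ‵fromℕ = Unique.allFin⁺ C
letters-unique (‵inj₁ _)  = unique-[-]

scanSteps-unique : ∀ s {b : Fin (suc C)} (v : View b) → Unique (scanSteps s v)
scanSteps-unique ⊢           _         = unique-[-]
scanSteps-unique ⊣           ‵fromℕ    = unique-[-]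
scanSteps-unique ⊣           (‵inj₁ _) = AllPairs.[]
scanSteps-unique (bit true)  v         = Unique.map⁺ (λ { refl → refl }) (letters-unique v)
scanSteps-unique (bit false) ‵fromℕ    = AllPairs.[]
scanSteps-unique (bit false) (‵inj₁ _) = unique-[-]

actions-unique : ∀ (q : State C) s gs → Unique (actions q s gs)
actions-unique accept         s gs = AllPairs.[]
actions-unique (scan b)       s gs = Unique.map⁺ (λ { refl → refl }) (scanSteps-unique s (view b))
actions-unique (work o g t b) s gs with workStep g o t b (lookup gs t)
... | just _  = unique-[-]
... | nothing = AllPairs.[]

ballotMachine : ℕ → NTM
ballotMachine C = record
  { State       = State C
  ; stateCount  = _
  ; finState    = state↔
  ; Symbol      = Symbol
  ; symbolCount = 3
  ; finSymbol   = symbol↔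
  ; blank       = nothing
  ; workTapes   = C
  ; start       = scan zero
  ; accepting   = λ { accept → true ; _ → false }
  ; δ           = actions
  ; δ-unique    = actions-unique
  }

------------------------------------------------------------------------
-- Counters on tapes

-- The part of the tape left of the head, nearest cell first, when the digits ls have
-- been passed.
leftOf : Digits → List Symbol
leftOf ls = map just ls ++ nothing ∷ []

-- A counter between operations: the head is on the blank cell left of the digits.
resting : Digits → Tape Symbol
resting ds = tape [] nothing (map just ds)

-- The head is on the first of the digits rs, or on the blank cell after the digits if
-- there are none; ls are the digits passed, in reverse.
carrying : Digits → Digits → Tape Symbol
carrying ls []       = tape (leftOf ls) nothing []
carrying ls (d ∷ rs) = tape (leftOf ls) (just d) (map just rs)

-- The digits ls are listed from the head leftwards, and rs are those to the right of
-- the head; if ls is empty, the head is on the blank cell left of all digits.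
returning : Digits → Digits → Tape Symbol
returning []       rs = resting rs
returning (l ∷ ls) rs = tape (leftOf ls) (just l) (map just rs)

length-leftOf : ∀ ls → length (leftOf ls) ≡ suc (length ls)
length-leftOf []       = refl
length-leftOf (_ ∷ ls) = cong suc (length-leftOf ls)

cells-resting : ∀ ds → visitedCells (resting ds) ≡ suc (length ds)
cells-resting ds = cong suc (length-map just ds)

cells-carrying : ∀ ls ds → visitedCells (carrying ls ds) ≤ 2 + (length ls + length ds)
cells-carrying ls []
  rewrite length-leftOf ls | +-identityʳ (length ls) | +-identityʳ (length ls + 1) | +-comm (length ls) 1
  = ≤-refl
cells-carrying ls (d ∷ ds)
  rewrite length-leftOf ls | length-map {B = Symbol} just ds | +-suc (length ls) (length ds) | +-comm (length ls) 1
  = n≤1+n _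

cells-returning : ∀ ls rs → visitedCells (returning ls rs) ≤ 1 + (length ls + length rs)
cells-returning []       rs = ≤-reflexive (cells-resting rs)
cells-returning (l ∷ ls) rs
  rewrite length-leftOf ls | length-map {B = Symbol} just rs | +-comm (length ls) 1
  = ≤-refl

all-≔ : {A : Set} {P : A → Set} {xs : Vec A n} → All P xs → (i : Fin n) → ∀ {y} → P y → All P (xs [ i ]≔ y)
all-≔ (_ ∷ ps) zero    q = q ∷ ps
all-≔ (p ∷ ps) (suc i) q = p ∷ all-≔ ps i q

all-replicate : ∀ {A : Set} {P : A → Set} {y} n → P y → All P (Vec.replicate n y)
all-replicate zero    p = []
all-replicate (suc n) p = p ∷ all-replicate n p

sum-bounded : ∀ {m} {xs : Vec ℕ n} → All (_≤ m) xs → Vec.sum xs ≤ n * m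
sum-bounded []       = z≤n
sum-bounded (p ∷ ps) = +-mono-≤ p (sum-bounded ps)

module _ {Γ : Set} {blank : Γ} where

  private
    act : Γ × Move → Tape Γ → Tape Γ
    act = writeAndMove blank

  act-unmoved : (ts : Vec (Tape Γ) n) → Vec.zipWith act (Vec.map (_, stay) (Vec.map Tape.head ts)) ts ≡ ts
  act-unmoved []       = refl
  act-unmoved (t ∷ ts) = cong (t ∷_) (act-unmoved ts)

  act-at : (ts : Vec (Tape Γ) n) (i : Fin n) (wm : Γ × Move) →
           Vec.zipWith act (Vec.map (_, stay) (Vec.map Tape.head ts) [ i ]≔ wm) ts ≡ updateAt ts i (act wm)
  act-at (t ∷ ts) zero    wm = cong (act wm t ∷_) (act-unmoved ts)
  act-at (t ∷ ts) (suc i) wm = cong (t ∷_) (act-at ts i wm)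

------------------------------------------------------------------------
-- Runs of the machine

-- The largest possible length of a counter on input x.
maxDigits : Word → ℕ
maxDigits x = 1 + ⌊log₂ length x ⌋

module Run {C : ℕ} (x : Word) where

  private
    ℓ : ℕ
    ℓ = maxDigits x

  open Computation (ballotMachine C) x public
  open Counting (ballotMachine C) x (C * (2 + ℓ)) public

  -- Apart from its digits, a tape has the blank cell on their left, and possibly the one
  -- on their right, visited when a carry or borrow runs past the last digit.
  Bounded : Tape Symbol → Set
  Bounded t = visitedCells t ≤ 2 + ℓ

  bounded⇒space : ∀ {q p ts} → All Bounded ts → workSpace (config q p ts) ≤ C * (2 + ℓ)
  bounded⇒space bounds = sum-bounded (All.map⁺ bounds)

  counter-bounded : ∀ ds → length ds ≤ ℓ → Bounded (resting ds)
  counter-bounded ds short = subst (_≤ 2 + ℓ) (sym (cells-resting ds)) (m≤n⇒m≤1+n (s≤s short))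

  -- An operation on tape t, while all other tapes ts and the input head p are at rest.
  module _ {p : ℕ} {ts : Vec (Tape Symbol) C} (bounds : All Bounded ts) (t : Fin C) (b : Fin (suc C)) where

    at : State C → Tape Symbol → Config
    at q u = config q p (ts [ t ]≔ u)

    space : ∀ {q u} → Bounded u → workSpace (at q u) ≤ C * (2 + ℓ)
    space {q} bound = bounded⇒space {q} {p} (all-≔ bounds t bound)

    private
      toActions : Tape Symbol → Maybe (State C × Symbol × Move) → List (Action (State C) Symbol C)
      toActions u r = List.fromMaybe (Maybe.map (workAction t (Vec.map Tape.head (ts [ t ]≔ u))) r)

    work-choices : ∀ o g u → choices (at (work o g t b) u) ≡ toActions u (workStep g o t b (Tape.head u))
    work-choices o g u = cong (λ s → toActions u (workStep g o t b s))
      (trans (lookup-map t Tape.head (ts [ t ]≔ u)) (cong Tape.head (lookup∘update t ts u)))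

    work-moves : ∀ {o g u q s m k} → Bounded u → workStep g o t b (Tape.head u) ≡ just (q , s , m) →
                 Counted (at q (writeAndMove nothing (s , m) u)) k → Counted (at (work o g t b) u) k
    work-moves {o} {g} {u} {q} {s} {m} {k} bound eq sub =
      counted-one (space {work o g t b} {u} bound) (λ ())
        (trans (work-choices o g u) (cong (toActions u) eq))
        (subst (λ us → Counted (config q p us) k) (sym moved) sub)
      where
      moved : _ ≡ ts [ t ]≔ writeAndMove nothing (s , m) u
      moved = trans (act-at (ts [ t ]≔ u) t (s , m)) (updateAt-updateAt t ts)

    move-left : ∀ ls {d rs} →
                moveHead nothing left (tape (leftOf ls) (just d) (map just rs)) ≡ returning ls (d ∷ rs)
    move-left []      = refl
    move-left (_ ∷ _) = refl

    move-right : ∀ {ls d} rs →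
                 moveHead nothing right (tape (leftOf ls) (just d) (map just rs)) ≡ carrying (d ∷ ls) rs
    move-right []      = refl
    move-right (_ ∷ _) = refl

    start-right : ∀ rs → moveHead nothing right (resting rs) ≡ carrying [] rs
    start-right []      = refl
    start-right (_ ∷ _) = refl

    to : ∀ {q u v k} → u ≡ v → Counted (at q v) k → Counted (at q u) k
    to refl counted = counted

    shift : ∀ (ls rs : Digits) {l d : Bool} {m} →
            length ls + length (d ∷ rs) ≤ m → length (l ∷ ls) + length rs ≤ m
    shift ls rs {m = m} = subst (_≤ m) (+-suc (length ls) (length rs))

    return : ∀ o ls rs {k} → length ls + length rs ≤ suc ℓ →
             Counted (at (done o t b) (resting (ls ʳ++ rs))) k →
             Counted (at (work o back t b) (returning ls rs)) k
    return o []       rs fits sub = work-moves (≤-trans (cells-returning [] rs) (s≤s fits)) refl sub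
    return o (l ∷ ls) rs fits sub = work-moves (≤-trans (cells-returning (l ∷ ls) rs) (s≤s fits)) refl
      (to (move-left ls) (return o ls (l ∷ rs) (subst (_≤ suc ℓ) (sym (+-suc (length ls) (length rs))) fits) sub))

    carry-bounded : ∀ ls ds → length ls + length ds ≤ ℓ → Bounded (carrying ls ds)
    carry-bounded ls ds fits = ≤-trans (cells-carrying ls ds) (s≤s (s≤s fits))

    carry-inc : ∀ ls ds {k} → length ls + length ds ≤ ℓ →
                Counted (at (done inc t b) (resting (ls ʳ++ increment ds))) k →
                Counted (at (work inc carry t b) (carrying ls ds)) k
    carry-inc ls [] fits sub = work-moves (carry-bounded ls [] fits) refl
      (to (move-left ls) (return inc ls (true ∷ []) (subst (_≤ suc ℓ) (sym (+-suc (length ls) 0)) (s≤s fits)) sub))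
    carry-inc ls (false ∷ ds) fits sub = work-moves (carry-bounded ls (false ∷ ds) fits) refl
      (to (move-left ls) (return inc ls (true ∷ ds) (m≤n⇒m≤1+n fits) sub))
    carry-inc ls (true ∷ ds) fits sub = work-moves (carry-bounded ls (true ∷ ds) fits) refl
      (to (move-right ds) (carry-inc (false ∷ ls) ds (shift ls ds {true} {true} fits) sub))

    -- What has to be shown about the configuration after a decrement with the given
    -- result: if there is no such configuration, then the number of paths is zero.
    AfterDecrement : Digits → Maybe Digits → ℕ → Set
    AfterDecrement ls nothing   k = k ≡ 0
    AfterDecrement ls (just ds) k = Counted (at (done dec t b) (resting (ls ʳ++ ds))) k

    carry-dec : ∀ ls ds {k} → length ls + length ds ≤ ℓ → AfterDecrement ls (decrement ds) k →
                Counted (at (work dec carry t b) (carrying ls ds)) k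
    carry-dec ls [] fits refl =
      counted-none (space {work dec carry t b} {carrying ls []} (carry-bounded ls [] fits)) (λ ())
        (work-choices dec carry (carrying ls []))
    carry-dec ls (true ∷ ds) fits sub = work-moves (carry-bounded ls (true ∷ ds) fits) refl
      (to (move-left ls) (return dec ls (false ∷ ds) (m≤n⇒m≤1+n fits) sub))
    carry-dec ls (false ∷ ds) {k} fits sub = work-moves (carry-bounded ls (false ∷ ds) fits) refl
      (to (move-right ds) (carry-dec (true ∷ ls) ds (shift ls ds {true} {true} fits) (after (decrement ds) sub)))
      where
      after : ∀ ds′ → AfterDecrement ls (Maybe.map (true ∷_) ds′) k → AfterDecrement (true ∷ ls) ds′ k
      after nothing  k≡0 = k≡0
      after (just _) sub = sub

    run-inc : ∀ ds {k} → length ds ≤ ℓ → Counted (at (done inc t b) (resting (increment ds))) k →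
              Counted (at (work inc start t b) (resting ds)) k
    run-inc ds short sub = work-moves (counter-bounded ds short) refl (to (start-right ds) (carry-inc [] ds short sub))

    run-dec : ∀ ds {k} → length ds ≤ ℓ → AfterDecrement [] (decrement ds) k →
              Counted (at (work dec start t b) (resting ds)) k
    run-dec ds short sub = work-moves (counter-bounded ds short) refl (to (start-right ds) (carry-dec [] ds short sub))

  counters : Vec Digits C → Vec (Tape Symbol) C
  counters = Vec.map resting

  counters-bounded : ∀ {dss} → All (λ ds → length ds ≤ ℓ) dss → All Bounded (counters dss)
  counters-bounded short = All.map⁺ (All.map (λ {ds} → counter-bounded ds) short)

  module _ {p : ℕ} {dss : Vec Digits C} (short : All (λ ds → length ds ≤ ℓ) dss) (t : Fin C) (b : Fin (suc C)) where

    private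
      bounds : All Bounded (counters dss)
      bounds = counters-bounded short

      focus : ∀ {q k} → Counted (config q p (counters dss [ t ]≔ resting (lookup dss t))) k →
              Counted (config q p (counters dss)) k
      focus {q} {k} = subst (λ ts → Counted (config q p ts) k)
        (trans (sym (map-[]≔ resting dss t)) (cong counters ([]≔-lookup dss t)))

      unfocus : ∀ {q ds k} → Counted (config q p (counters (dss [ t ]≔ ds))) k →
                Counted (config q p (counters dss [ t ]≔ resting ds)) k
      unfocus {q} {ds} {k} = subst (λ ts → Counted (config q p ts) k) (map-[]≔ resting dss t)

    counted-inc : ∀ {k} → Counted (config (done inc t b) p (counters (dss [ t ]≔ increment (lookup dss t)))) k →
                  Counted (config (work inc start t b) p (counters dss)) k
    counted-inc sub = focus (run-inc bounds t b (lookup dss t) (All.lookup⁺ short t) (unfocus sub))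

    counted-dec : ∀ {ds k} → decrement (lookup dss t) ≡ just ds →
                  Counted (config (scan b) p (counters (dss [ t ]≔ ds))) k →
                  Counted (config (work dec start t b) p (counters dss)) k
    counted-dec {k = k} eq sub = focus (run-dec bounds t b (lookup dss t) (All.lookup⁺ short t)
      (subst (λ r → AfterDecrement bounds t b [] r k) (sym eq) (unfocus sub)))

    counted-dec-zero : decrement (lookup dss t) ≡ nothing →
                       Counted (config (work dec start t b) p (counters dss)) 0
    counted-dec-zero eq = focus (run-dec bounds t b (lookup dss t) (All.lookup⁺ short t)
      (subst (λ r → AfterDecrement bounds t b [] r 0) (sym eq) refl))

  -- The counters dss represent the gaps of h, after r input symbols have been read.
  record Tracks (h : Vec ℕ C) (dss : Vec Digits C) (r : ℕ) : Set where
    constructor tracks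
    field
      gaps  : Gaps h dss
      small : All (λ ds → value ds ≤ r) dss
      short : All (λ ds → length ds ≤ ℓ) dss

module _ (x : Word) where

  open Run

  -- The machine processes the letter i: either the heights add i h are decreasing and it
  -- continues scanning with counters for them, or it gets stuck.
  counted-letter : ∀ {C p k r h dss} (i : Fin C) (b : Fin (suc C)) → r < length x → Tracks x h dss r →
    (∀ dss′ → Tracks x (add i h) dss′ (suc r) → Counted x (config (scan b) p (counters x dss′)) k) →
    Counted x (config (work inc start i b) p (counters x dss)) (whenDecreasing (add i h) k)
  counted-letter {C} {p} {k} {r} {h} {dss} i b r<N (tracks gaps small short) continue =
    counted-inc x short i b (after i gaps small′ short′ continue)
    where
    ds = lookup dss i
    dss₁ = dss [ i ]≔ increment ds
    inc-small : value (increment ds) ≤ suc r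
    inc-small = subst (_≤ suc r) (sym (value-increment ds)) (s≤s (All.lookup⁺ small i))
    small′ : All (λ ds → value ds ≤ suc r) dss₁
    small′ = all-≔ (All.map m≤n⇒m≤1+n small) i inc-small
    short′ : All (λ ds → length ds ≤ maxDigits x) dss₁
    short′ = all-≔ short i (increment-short ds (≤-trans inc-small r<N) (All.lookup⁺ short i))

    after : ∀ {C} {h : Vec ℕ C} {dss : Vec Digits C} {b} (i : Fin C) →
      let dss₁ = dss [ i ]≔ increment (lookup dss i) in
      Gaps h dss → All (λ ds → value ds ≤ suc r) dss₁ → All (λ ds → length ds ≤ maxDigits x) dss₁ →
      (∀ dss′ → Tracks x (add i h) dss′ (suc r) → Counted x (config (scan b) p (counters x dss′)) k) →
      Counted x (config (done inc i b) p (counters x dss₁)) (whenDecreasing (add i h) k)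
    after zero gaps small short continue =
      subst (Counted x _) (sym (whenDecreasing-yes (gaps⇒decreasing gaps′) k)) (continue _ (tracks gaps′ small short))
      where gaps′ = gaps-first gaps
    after {h = h} {dss} {b} (suc j) gaps small short continue = borrow (decrement es) refl (decrement-correct es)
      where
      incremented = dss [ suc j ]≔ increment (lookup dss (suc j))
      es = lookup incremented (inject₁ j)

      es-old : value es ≡ value (lookup dss (inject₁ j))
      es-old = cong value (lookup-pred dss j)

      borrow : ∀ r → decrement es ≡ r → DecrementOf es r →
               Counted x (config (work dec start (inject₁ j) b) _ (counters x incremented))
                         (whenDecreasing (add (suc j) h) k)
      borrow nothing eq es-zero =
        subst (Counted x _) (sym (whenDecreasing-no (gaps-blocked j (trans (sym es-old) es-zero) gaps) k))
          (counted-dec-zero x short (inject₁ j) b eq)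
      borrow (just es′) eq (es-suc , same-length) =
        subst (Counted x _) (sym (whenDecreasing-yes (gaps⇒decreasing gaps′) k))
          (counted-dec x short (inject₁ j) b eq (continue _ (tracks gaps′ small″ short″)))
        where
        gaps′ = gaps-later j (trans (sym es-old) es-suc) gaps
        small″ = all-≔ small (inject₁ j)
          (≤-trans (n≤1+n _) (subst (_≤ suc r) es-suc (All.lookup⁺ small (inject₁ j))))
        short″ = all-≔ short (inject₁ j) (subst (_≤ maxDigits x) (sym same-length) (All.lookup⁺ short (inject₁ j)))

------------------------------------------------------------------------
-- The scan of the input

module _ {C : ℕ} (x : Word) where

  open Run {C} x

  Tapes : Set
  Tapes = Vec (Tape Symbol) C

  scan-choices : ∀ {b p s} {ts : Tapes} → inputAt x p ≡ s →
                 choices (config (scan b) p ts) ≡ map (scanAction (Vec.map Tape.head ts)) (scanSteps s (view b))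
  scan-choices {b} {ts = ts} = cong (λ s → map (scanAction (Vec.map Tape.head ts)) (scanSteps s (view b)))

  scan-apply : ∀ {q q₀ m p k} {ts : Tapes} → Counted (config q (moveInput x m p) ts) k →
               Counted (apply (scanAction (Vec.map Tape.head ts) (q , m)) (config q₀ p ts)) k
  scan-apply {q} {m = m} {p} {k} {ts} =
    subst (λ us → Counted (config q (moveInput x m p) us) k) (sym (act-unmoved ts))

  scan-one : ∀ {b p s q m k} {ts : Tapes} → All Bounded ts → inputAt x p ≡ s →
             scanSteps s (view b) ≡ (q , m) ∷ [] →
             Counted (config q (moveInput x m p) ts) k → Counted (config (scan b) p ts) k
  scan-one {b} {p} {s} {q} {m} {ts = ts} bounds reads eq sub =
    counted-one (bounded⇒space {scan b} {p} bounds) (λ ())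
      (trans (scan-choices {b} {p} {ts = ts} reads) (cong (map _) eq))
      (scan-apply {q} {scan b} {m} {p} {ts = ts} sub)

  scan-stuck : ∀ {b p s} {ts : Tapes} → All Bounded ts → inputAt x p ≡ s →
               scanSteps s (view b) ≡ [] → Counted (config (scan b) p ts) 0
  scan-stuck {b} {p} {ts = ts} bounds reads eq =
    counted-none (bounded⇒space {scan b} {p} bounds) (λ ())
      (trans (scan-choices {b} {p} {ts = ts} reads) (cong (map _) eq))

  -- The input head is at position suc p, since position 0 holds the left end marker;
  -- y is the unread part of x, which starts there.
  counted-scan : ∀ {p h dss} (y : Word) (b : Fin (suc C)) →
                 (∀ j → inputAt x (j + suc p) ≡ inputAt y (suc j)) → p + length y ≡ length x →
                 Tracks h dss p →
                 Counted (config (scan b) (suc p) (counters dss)) (pathCount h b y)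
  counted-scan {p} {h} {dss} [] b reads total tr = finish (view b) refl
    where
    bounds = counters-bounded (Tracks.short tr)
    finish : ∀ {b} (v : View b) → view b ≡ v → Counted (config (scan b) (suc p) (counters dss)) (endValue v)
    finish ‵fromℕ eq = scan-one bounds (reads 0) (cong (scanSteps ⊣) eq)
      (accepts (bounded⇒space {accept} {suc p} bounds) refl tt)
    finish (‵inj₁ _) eq = scan-stuck bounds (reads 0) (cong (scanSteps ⊣) eq)
  counted-scan {p} {h} {dss} (s ∷ y) b reads total tr = read s (reads 0)
    where
    bounds = counters-bounded (Tracks.short tr)

    total′ : suc p + length y ≡ length x
    total′ = trans (sym (+-suc p (length y))) total

    p<N : p < length x
    p<N = subst (suc p ≤_) total′ (m≤m+n (suc p) (length y))

    reads′ : ∀ j → inputAt x (j + suc (suc p)) ≡ inputAt y (suc j)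
    reads′ j = trans (cong (inputAt x) (+-suc j (suc p))) (reads (suc j))

    to-right : ∀ {q ts k} → Counted (config q (suc (suc p)) ts) k →
               Counted (config q (moveInput x right (suc p)) ts) k
    to-right {q} {ts} {k} = subst (λ r → Counted (config q r ts) k) (sym (m≤n⇒m⊓n≡m (s≤s p<N)))

    read : ∀ s → inputAt x (suc p) ≡ bit s →
           Counted (config (scan b) (suc p) (counters dss)) (pathCount h b (s ∷ y))
    read true here = counted-map _ (letters (view b)) _ (bounded⇒space {scan b} {suc p} bounds) (λ ())
      (trans (scan-choices {b} {suc p} {ts = counters dss} here) (sym (map-∘ (letters (view b)))))
      (λ i → scan-apply {work inc start i b} {scan b} {right} {suc p} {ts = counters dss}
        (to-right (counted-letter x i b p<N tr
          (λ dss′ tr′ → counted-scan y b reads′ total′ tr′))))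
    read false here = next (view b) refl
      where
      next : ∀ {b} (v : View b) → view b ≡ v →
             Counted (config (scan b) (suc p) (counters dss)) (nextBlock v (λ b′ → pathCount h b′ y))
      next ‵fromℕ       eq = scan-stuck bounds here (cong (scanSteps (bit false)) eq)
      next (‵inject₁ i) eq = scan-one bounds here (cong (scanSteps (bit false)) eq)
        (to-right (counted-scan y (suc i) reads′ total′
          (tracks (Tracks.gaps tr) (All.map m≤n⇒m≤1+n (Tracks.small tr)) (Tracks.short tr))))

  -- The first step moves the input head off the left end marker.
  counted-initial : Counted initial (ballotFunction C x)
  counted-initial = subst₂ (λ ts → Counted (config (scan zero) 0 ts))
    (map-replicate resting [] C) (pathCount≡ballotFunction C x)
    (scan-one (counters-bounded short) refl refl
      (counted-scan x zero (λ j → cong (inputAt x) (+-comm j 1)) refl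
        (tracks (zeros-gaps C) (all-replicate C z≤n) short)))
    where
    short = all-replicate {P = λ ds → length ds ≤ maxDigits x} C z≤n

theorem3p13 : (C : ℕ) → #L (ballotFunction C)
theorem3p13 C = record
  { machine  = ballotMachine C
  ; halts    = λ x → Run.counted⇒halts x (counted-initial x)
  ; logSpace = C * 3 , λ x γ reached → ≤-trans (Run.counted⇒space x (counted-initial x) reached) (space x)
  ; counts   = λ x → Run.counted⇒paths x (counted-initial x)
  }
  where
  -- Each of the C tapes has at most 3 + ⌊log₂ |x|⌋ visited cells.
  space : ∀ x → C * (2 + maxDigits x) ≤ C * 3 * (1 + ⌊log₂ length x ⌋)
  space x = subst (C * (2 + maxDigits x) ≤_) (sym (*-assoc C 3 _)) (*-monoʳ-≤ C
    (subst (2 + maxDigits x ≤_) (sym (*-suc 3 ⌊log₂ length x ⌋)) (+-monoʳ-≤ 3 (m≤n*m ⌊log₂ length x ⌋ 3))))
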